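{- Let $n \geq 1$, and let $R \subseteq \mathcal{F}^n$ be a cardinality relation. The following properties are equivalent: (1) $R$ is definable in $(\mathbb{N},<)$; (2) $\mathcal{I}(R)$ is a finite union of sets of the form $E_1 \times \dots \times E_n$, where each $E_i$ is an ultimately periodic subset of $\mathbb{N}$ (i.e., $\mathcal{I}(R)$ is a recognizable subset of $\mathbb{N}^n$); (3) the two following properties hold: (a) every section of $\mathcal{I}(R)$ is Card-definable in $(\mathbb{N},<)$; (b) $\mathcal{I}(R)$ is strongly ultimately periodic.
   Context: $\mathcal{F}$ denotes the set of finite subsets of $\mathbb{N}$ and $|X|$ the cardinality of $X\in\mathcal{F}$. Definable means definable in weak monadic second-order logic (WMSO): formulas use first-order variables ranging over $\mathbb{N}$, monadic second-order variables ranging over finite subsets of $\mathbb{N}$, the membership predicate $x \in X$, and the symbols of the signature. A relation $R\subseteq\mathcal{F}^n$ is definable in a structure with domain $\mathbb{N}$ if there is a WMSO formula $\varphi(X_1,\dots,X_n)$ that holds exactly for the tuples of $R$. A relation $R\subseteq \mathcal{F}^n$ ($n\ge 1$) is a cardinality relation if for all $X_1,\dots,X_n,Y_1,\dots,Y_n\in\mathcal{F}$ with $|X_i|=|Y_i|$ for every $i\in\{1,\dots,n\}$, we have $(X_1,\dots,X_n)\in R$ iff $(Y_1,\dots,Y_n)\in R$. For such $R$, $\mathcal{I}(R)=\{(|X_1|,\dots,|X_n|) : (X_1,\dots,X_n)\in R\}\subseteq\mathbb{N}^n$. Conversely, for $S\subseteq\mathbb{N}^n$, $\mathcal{C}(S)$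 is the unique cardinality relation $R\subseteq\mathcal{F}^n$ with $\mathcal{I}(R)=S$. A set $S\subseteq\mathbb{N}^n$ is Card-definable in a structure with domain $\mathbb{N}$ if $\mathcal{C}(S)$ is definable in that structure. A set $E\subseteq \mathbb{N}$ is ultimately periodic if there exist integers $M$ and $p\geq 1$ such that for every integer $x\ge M$, $x\in E$ iff $x+p\in E$. The sections of $S\subseteq\mathbb{N}^n$ are the $(n-1)$-ary relations $S_{i,C}=\{(x_1,\dots,x_{i-1},x_{i+1},\dots,x_n) : (x_1,\dots,x_{i-1},C,x_{i+1},\dots,x_n)\in S\}$ for $i\in\{1,\dots,n\}$ and $C\in\mathbb{N}$. For $n=1$ sections are $0$-ary and are always considered Card-definable in $(\mathbb{N},<)$. A set $S\subseteq\mathbb{N}^n$ is strongly ultimately periodic if there exist $m\in\mathbb{N}$ and integers $p_1,\dots,p_n\ge 1$ such that for every $(x_1,\dots,x_n)\in\mathbb{N}^n$ with $x_i\ge m$ for all $i\in\{1,\dots,n\}$ and every $j\in\{1,\dots,n\}$, we have $(x_1,\dots,x_n)\in S$ iff $(x_1,\dots,x_{j-1},x_j+p_j,x_{j+1},\dots,x_n)\in S$. -}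

module Defs where

open import Data.Fin.Base using (Fin)
open import Data.List.Fresh using (List#; []; cons; length; _#_)
import Data.List.Fresh.Membership.Setoid as FreshMembership
open import Data.Nat.Base using (ℕ; zero; suc; _+_; _≤_; _<_; _≥_)
open import Data.Nat.Properties using (≤-refl; m<n⇒m<1+n)
open import Data.Product.Base using (Σ-syntax; ∃-syntax; _×_; _,_)
open import Data.Sum.Base using (_⊎_)
open import Data.Unit.Base using (⊤)
open import Data.Vec.Base using (Vec; []; _∷_; lookup; map; insertAt; _[_]%=_)
open import Data.Vec.Properties using (lookup-map; tabulate∘lookup; tabulate-cong)
open import Function.Bundles using (_⇔_; mk⇔; module Equivalence)
open import Level using (0ℓ)
open import Relation.Binary.PropositionalEquality
  using (_≡_; refl; sym; trans; cong; cong₂; subst)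
open import Relation.Binary.PropositionalEquality.Properties using (setoid)
open import Relation.Nullary.Negation.Core using (¬_)
open import Relation.Unary using (Pred; _≐_)

open FreshMembership (setoid ℕ) using (_∈_)

private
  variable
    n a b : ℕ

-- A finite set of naturals is the strictly increasing list of its elements,
-- so there is one list per set, and its length is the cardinality.

𝓕 : Set
𝓕 = List# ℕ _<_

∣_∣ : 𝓕 → ℕ
∣ X ∣ = length X

-- WMSO formulas over the signature {<} (with equality), in de Bruijn style:
-- Formula a b has a free first-order and b free second-order variables, and
-- a quantifier binds index zero of the corresponding sort.

infix  6 _<ᶠ_ _≡ᶠ_ _∈ᶠ_
infix  5 ¬ᶠ_
infixr 4 _∧ᶠ_
infixr 3 _∨ᶠ_

data Formula : ℕ → ℕ → Set where
  _<ᶠ_ _≡ᶠ_ : Fin a → Fin a → Formula a b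
  _∈ᶠ_      : Fin a → Fin b → Formula a b
  ¬ᶠ_       : Formula a b → Formula a b
  _∧ᶠ_ _∨ᶠ_ : Formula a b → Formula a b → Formula a b
  ∃₁ ∀₁     : Formula (suc a) b → Formula a b
  ∃₂ ∀₂     : Formula a (suc b) → Formula a b

infix 3 ⟨ℕ,<⟩⊨_[_,_]

⟨ℕ,<⟩⊨_[_,_] : Formula a b → Vec ℕ a → Vec 𝓕 b → Set
⟨ℕ,<⟩⊨ x <ᶠ y   [ xs , Xs ] = lookup xs x < lookup xs y
⟨ℕ,<⟩⊨ x ≡ᶠ y   [ xs , Xs ] = lookup xs x ≡ lookup xs y
⟨ℕ,<⟩⊨ x ∈ᶠ X   [ xs , Xs ] = lookup xs x ∈ lookup Xs X
⟨ℕ,<⟩⊨ ¬ᶠ φ     [ xs , Xs ] = ¬ (⟨ℕ,<⟩⊨ φ [ xs , Xs ])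
⟨ℕ,<⟩⊨ φ ∧ᶠ ψ   [ xs , Xs ] = (⟨ℕ,<⟩⊨ φ [ xs , Xs ]) × (⟨ℕ,<⟩⊨ ψ [ xs , Xs ])
⟨ℕ,<⟩⊨ φ ∨ᶠ ψ   [ xs , Xs ] = (⟨ℕ,<⟩⊨ φ [ xs , Xs ]) ⊎ (⟨ℕ,<⟩⊨ ψ [ xs , Xs ])
⟨ℕ,<⟩⊨ ∃₁ φ     [ xs , Xs ] = ∃[ x ] (⟨ℕ,<⟩⊨ φ [ x ∷ xs , Xs ])
⟨ℕ,<⟩⊨ ∀₁ φ     [ xs , Xs ] = ∀ x → ⟨ℕ,<⟩⊨ φ [ x ∷ xs , Xs ]
⟨ℕ,<⟩⊨ ∃₂ φ     [ xs , Xs ] = ∃[ X ] (⟨ℕ,<⟩⊨ φ [ xs , X ∷ Xs ])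
⟨ℕ,<⟩⊨ ∀₂ φ     [ xs , Xs ] = ∀ X → ⟨ℕ,<⟩⊨ φ [ xs , X ∷ Xs ]

Definable : Pred (Vec 𝓕 n) 0ℓ → Set
Definable {n} R = Σ[ φ ∈ Formula 0 n ] (∀ Xs → R Xs ⇔ (⟨ℕ,<⟩⊨ φ [ [] , Xs ]))

IsCardinalityRelation : Pred (Vec 𝓕 n) 0ℓ → Set
IsCardinalityRelation R =
  ∀ Xs Ys → (∀ i → ∣ lookup Xs i ∣ ≡ ∣ lookup Ys i ∣) → R Xs ⇔ R Ys

𝓘 : Pred (Vec 𝓕 n) 0ℓ → Pred (Vec ℕ n) 0ℓ
𝓘 R xs = ∃[ Xs ] R Xs × map ∣_∣ Xs ≡ xs

-- 𝓒 S is characterised by 𝓒-isCardinalityRelation, 𝓘∘𝓒 and 𝓒-unique below.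

𝓒 : Pred (Vec ℕ n) 0ℓ → Pred (Vec 𝓕 n) 0ℓ
𝓒 S Xs = S (map ∣_∣ Xs)

-- By convention, 0-ary relations are always Card-definable.

CardDefinable : Pred (Vec ℕ n) 0ℓ → Set
CardDefinable {zero}  S = ⊤
CardDefinable {suc n} S = Definable (𝓒 S)

Section : Pred (Vec ℕ (suc n)) 0ℓ → Fin (suc n) → ℕ → Pred (Vec ℕ n) 0ℓ
Section S i C xs = S (insertAt xs i C)

UltimatelyPeriodic : Pred ℕ 0ℓ → Set
UltimatelyPeriodic E =
  ∃[ M ] ∃[ p ] p ≥ 1 × (∀ x → x ≥ M → E x ⇔ E (x + p))

Recognizable : Pred (Vec ℕ n) 0ℓ → Set₁
Recognizable {n} S =
  Σ[ k ∈ ℕ ] Σ[ E ∈ (Fin k → Fin n → Pred ℕ 0ℓ) ]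
    (∀ l i → UltimatelyPeriodic (E l i)) ×
    (∀ xs → S xs ⇔ (∃[ l ] ∀ i → E l i (lookup xs i)))

StronglyUltimatelyPeriodic : Pred (Vec ℕ n) 0ℓ → Set
StronglyUltimatelyPeriodic {n} S =
  Σ[ m ∈ ℕ ] Σ[ p ∈ (Fin n → ℕ) ]
    (∀ i → p i ≥ 1) ×
    (∀ xs → (∀ i → lookup xs i ≥ m) →
     ∀ j → S xs ⇔ S (xs [ j ]%= (_+ p j)))

interval   : ℕ → ℕ → 𝓕
interval-# : ∀ {x} s k → x < s → x # interval s k

interval s zero    = []
interval s (suc k) = cons s (interval (suc s) k) (interval-# (suc s) k ≤-refl)

interval-# s zero    x<s = _
interval-# s (suc k) x<s = x<s , interval-# (suc s) k (m<n⇒m<1+n x<s)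

∣interval∣ : ∀ s k → ∣ interval s k ∣ ≡ k
∣interval∣ s zero    = refl
∣interval∣ s (suc k) = cong suc (∣interval∣ (suc s) k)

map-∣interval∣ : (xs : Vec ℕ n) → map ∣_∣ (map (interval 0) xs) ≡ xs
map-∣interval∣ []       = refl
map-∣interval∣ (x ∷ xs) = cong₂ _∷_ (∣interval∣ 0 x) (map-∣interval∣ xs)

𝓒-isCardinalityRelation : (S : Pred (Vec ℕ n) 0ℓ) → IsCardinalityRelation (𝓒 S)
𝓒-isCardinalityRelation S Xs Ys eq = mk⇔ (subst S same) (subst S (sym same))
  where
  pointwise : ∀ i → lookup (map ∣_∣ Xs) i ≡ lookup (map ∣_∣ Ys) i
  pointwise i = trans (lookup-map i ∣_∣ Xs) (trans (eq i) (sym (lookup-map i ∣_∣ Ys)))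

  same : map ∣_∣ Xs ≡ map ∣_∣ Ys
  same = trans (sym (tabulate∘lookup _)) (trans (tabulate-cong pointwise) (tabulate∘lookup _))

𝓘∘𝓒 : (S : Pred (Vec ℕ n) 0ℓ) → 𝓘 (𝓒 S) ≐ S
𝓘∘𝓒 S =
  (λ { (Xs , s , eq) → subst S eq s }) ,
  (λ {xs} s → map (interval 0) xs , subst S (sym (map-∣interval∣ xs)) s , map-∣interval∣ xs)

𝓒-unique : (S : Pred (Vec ℕ n) 0ℓ) (R : Pred (Vec 𝓕 n) 0ℓ) →
           IsCardinalityRelation R → 𝓘 R ≐ S → R ≐ 𝓒 S
𝓒-unique S R card (I⊆S , S⊆I) =
  (λ {Xs} r → I⊆S (Xs , r , refl)) ,
  (λ {Xs} s → let (Ys , r , eq) = S⊆I s in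
    Equivalence.to
      (card Ys Xs λ i → trans (sym (lookup-map i ∣_∣ Ys))
                        (trans (cong (λ v → lookup v i) eq) (lookup-map i ∣_∣ Xs)))
      r)

{-# OPTIONS --safe #-}

-- Definable relations are recognised by automata.  Encode finite sets as Boolean
-- words, all on parallel tracks, read from right to left.  If the j-th set is
-- an interval of length x placed to the right of all the other sets, the state
-- reached after it is an ultimately periodic function of x alone; hence 𝓘 R is
-- ultimately periodic along each axis, uniformly in the other coordinates, and
-- a relation with this property is a union of boxes of residue classes.
-- Conversely, WMSO expresses that |X| lies in a progression c + pℕ: every set that
-- contains the c-th element of X and is closed under p-fold successors in X
-- contains the last element of X.
-- Finally, strong ultimate periodicity bounds the period along an axis only
-- where the other coordinates are ≥ m; if one of them is C < m, the point lies
-- in one of the finitely many sections S_{i,C}, which are periodic by themselves.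

module Submission where

open import Defs
open import Axiom.ExcludedMiddle using (ExcludedMiddle)
open import Data.Bool.Base using (Bool; true; false)
open import Data.Fin.Base using (Fin; zero; suc; toℕ; fromℕ<; combine; funToFin; finToFun; punchIn; punchOut)
import Data.Fin.Properties as Fin
open import Data.List.Base as List using (List; []; _∷_; _++_; length)
open import Data.List.Fresh using ([]; cons; _#_)
import Data.List.Fresh.Membership.Setoid as FreshMembership
open import Data.List.Fresh.Relation.Unary.Any using (here; there)
open import Data.List.Properties using (length-replicate)
open import Data.Nat.Base using (ℕ; zero; suc; _+_; _*_; _^_; _∸_; _⊔_; _≤_; _<_; _≥_; z≤n; s≤s; >-nonZero)
open import Data.Nat.DivMod using (_/_; _%_; m≡m%n+[m/n]*n; m%n<n)
open import Data.Nat.Properties using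
  (suc-injective; _<?_; ≤-refl; ≤-reflexive; ≤-trans; <⇒≤; ≤⇒≯; ≮⇒≥; <-irrefl; <-cmp; n<1+n; m<n⇒m<1+n;
   m≤m+n; m≤n+m; m+n≮m; m+1+n≰m; m<n⇒0<n∸m; m≤n⇒∃[o]m+o≡n; m∸n+n≡m; m+[n∸m]≡n;
   +-suc; +-assoc; +-comm; +-identityʳ; +-monoˡ-≤; +-monoʳ-<; +-cancelˡ-<; +-cancelʳ-≡;
   *-comm; *-zeroʳ; *-mono-≤; m≤m⊔n; m≤n⊔m; m⊔n≤o⇒m≤o; m⊔n≤o⇒n≤o)
open import Data.Product.Base as Product using (Σ-syntax; ∃-syntax; _×_; _,_; proj₁; proj₂)
open import Data.Sum.Base as Sum using (_⊎_; inj₁; inj₂; [_,_]′)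
open import Data.Unit.Base using (⊤; tt)
open import Data.Vec.Base as Vec using (Vec; []; _∷_; lookup; map; tabulate; insertAt; removeAt; _[_]≔_; _[_]%=_)
open import Data.Vec.Properties using
  (lookup-map; lookup∘tabulate; lookup∘updateAt; lookup∘updateAt′; updateAt-updateAt;
   map-id; map-cong; map-∘; map-replicate; map-[]≔; insertAt-lookup; insertAt-punchIn; insertAt-removeAt)
open import Data.Vec.Relation.Binary.Pointwise.Inductive as Pointwise using (Pointwise; []; _∷_)
open import Function.Base using (_∘_; id)
open import Function.Bundles using (_⇔_; mk⇔; module Equivalence)
open import Function.Properties.Equivalence using (⇔-isEquivalence)
open import Level using (0ℓ)
open import Relation.Binary.Definitions using (tri<; tri≈; tri>)
open import Relation.Binary.PropositionalEquality using (_≡_; refl; sym; trans; cong; cong₂; subst; subst₂; setoid)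
open import Relation.Binary.Structures using (IsEquivalence)
open import Relation.Nullary.Decidable.Core using (yes; no)
open import Relation.Nullary.Negation.Core using (¬_; contradiction)
open import Relation.Unary using (Pred)

open FreshMembership (setoid ℕ) using (_∈_)
open Equivalence using (to; from)
module ⇔ = IsEquivalence (⇔-isEquivalence {0ℓ})

private
  variable
    a b n : ℕ

-- Finite sets as Boolean words

Word : Set
Word = List Bool

head : Word → Bool
head []      = false
head (b ∷ W) = b

tail : Word → Word
tail []      = []
tail (b ∷ W) = W

infix 4 _∈ʷ_

-- Going through the total functions `head` and `tail` pads every word with zeros, so tracks of
-- different lengths can be read in parallel.
_∈ʷ_ : ℕ → Word → Set
zero  ∈ʷ W = head W ≡ true
suc j ∈ʷ W = j ∈ʷ tail W

∉ʷ[] : ∀ j → ¬ j ∈ʷ []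
∉ʷ[] (suc j) = ∉ʷ[] j

count : Word → ℕ
count []          = 0
count (true ∷ W)  = suc (count W)
count (false ∷ W) = count W

infix 4 _≈_

-- A relation and not a function, since one set has many words, which differ in their trailing
-- zeros.
_≈_ : 𝓕 → Word → Set
X ≈ W = ∀ j → j ∈ X ⇔ j ∈ʷ W

fromWord   : ℕ → Word → 𝓕
fromWord-# : ∀ {x} s W → x < s → x # fromWord s W

fromWord s []          = []
fromWord s (true ∷ W)  = cons s (fromWord (suc s) W) (fromWord-# (suc s) W ≤-refl)
fromWord s (false ∷ W) = fromWord (suc s) W

fromWord-# s []          x<s = _
fromWord-# s (true ∷ W)  x<s = x<s , fromWord-# (suc s) W (m<n⇒m<1+n x<s)
fromWord-# s (false ∷ W) x<s = fromWord-# (suc s) W (m<n⇒m<1+n x<s)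

∣fromWord∣ : ∀ s W → ∣ fromWord s W ∣ ≡ count W
∣fromWord∣ s []          = refl
∣fromWord∣ s (true ∷ W)  = cong suc (∣fromWord∣ (suc s) W)
∣fromWord∣ s (false ∷ W) = ∣fromWord∣ (suc s) W

∈-fromWord⁻ : ∀ {x} s W → x ∈ fromWord s W → ∃[ j ] x ≡ s + j × j ∈ʷ W
∈-fromWord⁻ s (true ∷ W)  (here refl) = 0 , sym (+-identityʳ s) , refl
∈-fromWord⁻ s (true ∷ W)  (there x∈) with j , refl , j∈ ← ∈-fromWord⁻ (suc s) W x∈ =
  suc j , sym (+-suc s j) , j∈
∈-fromWord⁻ s (false ∷ W) x∈ with j , refl , j∈ ← ∈-fromWord⁻ (suc s) W x∈ =
  suc j , sym (+-suc s j) , j∈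

∈-fromWord⁺ : ∀ s W j → j ∈ʷ W → s + j ∈ fromWord s W
∈-fromWord⁺ s []          j       j∈ = contradiction j∈ (∉ʷ[] j)
∈-fromWord⁺ s (true ∷ W)  zero    j∈ = here (+-identityʳ s)
∈-fromWord⁺ s (true ∷ W)  (suc j) j∈ =
  there (subst (_∈ fromWord (suc s) W) (sym (+-suc s j)) (∈-fromWord⁺ (suc s) W j j∈))
∈-fromWord⁺ s (false ∷ W) (suc j) j∈ =
  subst (_∈ fromWord (suc s) W) (sym (+-suc s j)) (∈-fromWord⁺ (suc s) W j j∈)

fromWord≈ : ∀ W → fromWord 0 W ≈ W
fromWord≈ W j = mk⇔ (λ j∈ → let (_ , eq , k∈) = ∈-fromWord⁻ 0 W j∈ in subst (_∈ʷ W) (sym eq) k∈)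
                    (∈-fromWord⁺ 0 W j)

insert : ℕ → Word → Word
insert zero    W = true ∷ tail W
insert (suc x) W = head W ∷ insert x (tail W)

∈-insert : ∀ x W j → j ∈ʷ insert x W ⇔ (j ≡ x ⊎ j ∈ʷ W)
∈-insert zero    W zero    = mk⇔ (λ _ → inj₁ refl) (λ _ → refl)
∈-insert zero    W (suc j) = mk⇔ inj₂ λ { (inj₁ ()) ; (inj₂ j∈) → j∈ }
∈-insert (suc x) W zero    = mk⇔ inj₂ λ { (inj₁ ()) ; (inj₂ j∈) → j∈ }
∈-insert (suc x) W (suc j) = mk⇔
  (λ j∈ → Sum.map₁ (cong suc) (to (∈-insert x (tail W) j) j∈))
  (λ j∈ → from (∈-insert x (tail W) j) (Sum.map₁ suc-injective j∈))

count-insert : ∀ x W → ¬ x ∈ʷ W → count (insert x W) ≡ suc (count W)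
count-insert zero    []          x∉ = refl
count-insert zero    (true ∷ W)  x∉ = contradiction refl x∉
count-insert zero    (false ∷ W) x∉ = refl
count-insert (suc x) []          x∉ = count-insert x [] x∉
count-insert (suc x) (true ∷ W)  x∉ = cong suc (count-insert x W x∉)
count-insert (suc x) (false ∷ W) x∉ = count-insert x W x∉

#⇒< : ∀ {x y} (X : 𝓕) → x # X → y ∈ X → x < y
#⇒< (cons _ X _) (x<z , _)   (here refl) = x<z
#⇒< (cons _ X _) (_   , x#X) (there y∈)  = #⇒< X x#X y∈

toWord : 𝓕 → Word
toWord []           = []
toWord (cons x X _) = insert x (toWord X)

≈toWord : ∀ X → X ≈ toWord X
≈toWord []           j = mk⇔ (λ ()) λ j∈ → contradiction j∈ (∉ʷ[] j)
≈toWord (cons x X _) j = mk⇔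
  (λ { (here eq)  → from (∈-insert x (toWord X) j) (inj₁ eq)
     ; (there j∈) → from (∈-insert x (toWord X) j) (inj₂ (to (≈toWord X j) j∈)) })
  (λ j∈ → [ here , there ∘ from (≈toWord X j) ]′ (to (∈-insert x (toWord X) j) j∈))

count-toWord : ∀ X → count (toWord X) ≡ ∣ X ∣
count-toWord []             = refl
count-toWord (cons x X x#X) =
  trans (count-insert x (toWord X) (<-irrefl refl ∘ #⇒< X x#X ∘ from (≈toWord X x)))
        (cong suc (count-toWord X))

-- The track of a first-order variable. It ends with its only one, so what lies behind that letter
-- is exactly `[]`; `project₁` relies on this.
singleton : ℕ → Word
singleton zero    = true ∷ []
singleton (suc x) = false ∷ singleton x

∈-singleton⁻ : ∀ x j → j ∈ʷ singleton x → j ≡ x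
∈-singleton⁻ zero    zero    j∈ = refl
∈-singleton⁻ zero    (suc j) j∈ = contradiction j∈ (∉ʷ[] j)
∈-singleton⁻ (suc x) (suc j) j∈ = cong suc (∈-singleton⁻ x j j∈)

∈-singleton⁺ : ∀ x → x ∈ʷ singleton x
∈-singleton⁺ zero    = refl
∈-singleton⁺ (suc x) = ∈-singleton⁺ x

-- Automata on parallel tracks

-- A deterministic finite automaton reading words from right to left, given
-- by its run.  Since the tail of [] is [], trailing zeros are harmless.

record Congruence (a b : ℕ) : Set where
  field
    size  : ℕ
    τ     : Vec Word a → Vec Word b → Fin size
    congr : ∀ us us′ Vs Vs′ → map head us ≡ map head us′ → map head Vs ≡ map head Vs′ →
            τ (map tail us) (map tail Vs) ≡ τ (map tail us′) (map tail Vs′) →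
            τ us Vs ≡ τ us′ Vs′

open Congruence

-- Instead of accepting states: equal states force equal truth values of `φ`. The condition is
-- symmetric in the two tuples, so one implication is enough and a negation can keep its automaton.
Sound : Congruence a b → Formula a b → Set
Sound A φ = ∀ xs xs′ {Xs Xs′ Vs Vs′} → Pointwise _≈_ Xs Vs → Pointwise _≈_ Xs′ Vs′ →
            τ A (map singleton xs) Vs ≡ τ A (map singleton xs′) Vs′ →
            ⟨ℕ,<⟩⊨ φ [ xs , Xs ] → ⟨ℕ,<⟩⊨ φ [ xs′ , Xs′ ]

infixr 4 _⊗_

_⊗_ : Congruence a b → Congruence a b → Congruence a b
(A ⊗ B) .size = size A * size B
(A ⊗ B) .τ us Vs = combine (τ A us Vs) (τ B us Vs)
(A ⊗ B) .congr us us′ Vs Vs′ h H eq =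
  let (eqᴬ , eqᴮ) = Fin.combine-injective (τ A _ _) (τ B _ _) _ _ eq
  in cong₂ combine (congr A us us′ Vs Vs′ h H eqᴬ) (congr B us us′ Vs Vs′ h H eqᴮ)

-- Runs for atomic formulas and for quantifiers

Meets : Word → Word → Set
Meets u v = ∃[ j ] j ∈ʷ u × j ∈ʷ v

Meets-step : ∀ {u u′ v v′} → head u ≡ head u′ → head v ≡ head v′ →
             (Meets (tail u) (tail v) → Meets (tail u′) (tail v′)) → Meets u v → Meets u′ v′
Meets-step hu hv rec (zero  , u₀ , v₀) = zero , trans (sym hu) u₀ , trans (sym hv) v₀
Meets-step hu hv rec (suc j , uⱼ , vⱼ) = let (j′ , p) = rec (j , uⱼ , vⱼ) in suc j′ , p

NonEmpty : Word → Set
NonEmpty v = ∃[ j ] j ∈ʷ v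

NonEmpty-step : ∀ {v v′} → head v ≡ head v′ →
                (NonEmpty (tail v) → NonEmpty (tail v′)) → NonEmpty v → NonEmpty v′
NonEmpty-step hv rec (zero  , v₀) = zero , trans (sym hv) v₀
NonEmpty-step hv rec (suc j , vⱼ) = let (j′ , p) = rec (j , vⱼ) in suc j′ , p

Before : Word → Word → Set
Before u v = ∃[ i ] ∃[ j ] i < j × i ∈ʷ u × j ∈ʷ v

-- When `u` begins with a one, any later one in `v` suffices. This is why the automaton for the
-- order must also remember `NonEmpty` of the second track.
Before-step : ∀ {u u′ v v′} → head u ≡ head u′ →
              (NonEmpty (tail v) → NonEmpty (tail v′)) →
              (Before (tail u) (tail v) → Before (tail u′) (tail v′)) → Before u v → Before u′ v′
Before-step hu nonEmpty rec (zero , suc j , _ , u₀ , vⱼ) =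
  let (j′ , p) = nonEmpty (j , vⱼ) in zero , suc j′ , s≤s z≤n , trans (sym hu) u₀ , p
Before-step hu nonEmpty rec (suc i , suc j , s≤s i<j , uᵢ , vⱼ) =
  let (i′ , j′ , i′<j′ , p) = rec (i , j , i<j , uᵢ , vⱼ) in suc i′ , suc j′ , s≤s i′<j′ , p

-- Both sorts of variables become tracks, so that the automata for atoms need not distinguish them.
Track : ℕ → ℕ → Set
Track a b = Fin a ⊎ Fin b

track : ∀ {A : Set} → Track a b → Vec A a → Vec A b → A
track (inj₁ x) us Vs = lookup us x
track (inj₂ X) us Vs = lookup Vs X

track-map : ∀ {A B : Set} (f : A → B) (t : Track a b) us Vs →
            track t (map f us) (map f Vs) ≡ f (track t us Vs)
track-map f (inj₁ x) us Vs = lookup-map x f us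
track-map f (inj₂ X) us Vs = lookup-map X f Vs

track-cong : ∀ {A B : Set} (f : A → B) (t : Track a b) {us us′ Vs Vs′} →
             map f us ≡ map f us′ → map f Vs ≡ map f Vs′ → f (track t us Vs) ≡ f (track t us′ Vs′)
track-cong f t {us} {us′} {Vs} {Vs′} eq Eq =
  trans (sym (track-map f t us Vs)) (trans (cong₂ (track t) eq Eq) (track-map f t us′ Vs′))

funToFin-cong : ∀ {m n} {f g : Fin m → Fin n} → (∀ i → f i ≡ g i) → funToFin f ≡ funToFin g
funToFin-cong {zero}  eq = refl
funToFin-cong {suc m} eq = cong₂ combine (eq zero) (funToFin-cong (eq ∘ suc))

-- The state sets of the subset construction. The guessed word has arbitrary length, which covers
-- witnesses longer than all other tracks.
Reachable₂ : ∀ (A : Congruence a (suc b)) → Vec Word a → Vec Word b → Fin (size A) → Set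
Reachable₂ A us Vs q = ∃[ W ] τ A us (W ∷ Vs) ≡ q

Reachable₁ : ∀ (A : Congruence (suc a) b) → Vec Word a → Vec Word b → Fin (size A) → Set
Reachable₁ A us Vs q = ∃[ x ] τ A (singleton x ∷ us) Vs ≡ q

module _ (em : ExcludedMiddle 0ℓ) where

  -- Excluded middle turns a proposition into one of two states, so that a run can be defined
  -- directly by a property of the words.
  ⟦_⟧ : Set → Fin 2
  ⟦ P ⟧ with em {P}
  ... | yes _ = zero
  ... | no  _ = suc zero

  ⟦⟧-cong : ∀ {P Q : Set} → (P → Q) → (Q → P) → ⟦ P ⟧ ≡ ⟦ Q ⟧
  ⟦⟧-cong {P} {Q} f g with em {P} | em {Q}
  ... | yes _ | yes _  = refl
  ... | yes p | no ¬q  = contradiction (f p) ¬q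
  ... | no ¬p | yes q  = contradiction (g q) ¬p
  ... | no _  | no _   = refl

  ⟦⟧-transport : ∀ {P Q : Set} → ⟦ P ⟧ ≡ ⟦ Q ⟧ → P → Q
  ⟦⟧-transport {P} {Q} eq p with em {P} | em {Q} | eq
  ... | _     | yes q | _ = q
  ... | no ¬p | no _  | _ = contradiction p ¬p

  subset : ∀ {k} → (Fin k → Set) → Fin (2 ^ k)
  subset P = funToFin (⟦_⟧ ∘ P)

  subset-cong : ∀ {k} {P Q : Fin k → Set} → (∀ i → P i → Q i) → (∀ i → Q i → P i) →
                subset P ≡ subset Q
  subset-cong f g = funToFin-cong λ i → ⟦⟧-cong (f i) (g i)

  subset-transport : ∀ {k} (P Q : Fin k → Set) → subset P ≡ subset Q → ∀ i → P i → Q i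
  subset-transport P Q eq i = ⟦⟧-transport
    (trans (sym (Fin.finToFun-funToFin (⟦_⟧ ∘ P) i))
           (trans (cong (λ k → finToFun k i) eq) (Fin.finToFun-funToFin (⟦_⟧ ∘ Q) i)))

  Reachable₂-transport : ∀ (A : Congruence a (suc b)) us us′ Vs Vs′ →
    subset (Reachable₂ A us Vs) ≡ subset (Reachable₂ A us′ Vs′) →
    ∀ W → ∃[ W′ ] τ A us′ (W′ ∷ Vs′) ≡ τ A us (W ∷ Vs)
  Reachable₂-transport A us us′ Vs Vs′ eq W =
    subset-transport (Reachable₂ A us Vs) (Reachable₂ A us′ Vs′) eq _ (W , refl)

  Reachable₁-transport : ∀ (A : Congruence (suc a) b) us us′ Vs Vs′ →
    subset (Reachable₁ A us Vs) ≡ subset (Reachable₁ A us′ Vs′) →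
    ∀ x → ∃[ x′ ] τ A (singleton x′ ∷ us′) Vs′ ≡ τ A (singleton x ∷ us) Vs
  Reachable₁-transport A us us′ Vs Vs′ eq x =
    subset-transport (Reachable₁ A us Vs) (Reachable₁ A us′ Vs′) eq _ (x , refl)

  -- On two singleton tracks this decides equality, on a singleton track and a set track membership;
  -- one automaton serves both atoms.
  meets : Track a b → Track a b → Congruence a b
  meets s t .size = 2
  meets s t .τ us Vs = ⟦ Meets (track s us Vs) (track t us Vs) ⟧
  meets {a} {b} s t .congr us us′ Vs Vs′ h H eq =
    ⟦⟧-cong (step us us′ Vs Vs′ h H (⟦⟧-transport eq))
            (step us′ us Vs′ Vs (sym h) (sym H) (⟦⟧-transport (sym eq)))
    where
    P : Vec Word a → Vec Word b → Set
    P us Vs = Meets (track s us Vs) (track t us Vs)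

    step : ∀ us us′ Vs Vs′ → map head us ≡ map head us′ → map head Vs ≡ map head Vs′ →
           (P (map tail us) (map tail Vs) → P (map tail us′) (map tail Vs′)) →
           P us Vs → P us′ Vs′
    step us us′ Vs Vs′ h H rec = Meets-step (track-cong head s h H) (track-cong head t h H)
      (subst₂ Meets (track-map tail s us′ Vs′) (track-map tail t us′ Vs′) ∘ rec ∘
       subst₂ Meets (sym (track-map tail s us Vs)) (sym (track-map tail t us Vs)))

  before : Track a b → Track a b → Congruence a b
  before s t .size = 2 * 2
  before s t .τ us Vs =
    combine ⟦ Before (track s us Vs) (track t us Vs) ⟧ ⟦ NonEmpty (track t us Vs) ⟧
  before {a} {b} s t .congr us us′ Vs Vs′ h H eq =
    let (eqᴮ , eqᴺ) = Fin.combine-injective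
          ⟦ B (map tail us) (map tail Vs) ⟧   ⟦ N (map tail us) (map tail Vs) ⟧
          ⟦ B (map tail us′) (map tail Vs′) ⟧ ⟦ N (map tail us′) (map tail Vs′) ⟧ eq
    in cong₂ combine
      (⟦⟧-cong (stepᴮ us us′ Vs Vs′ h H (⟦⟧-transport eqᴺ) (⟦⟧-transport eqᴮ))
               (stepᴮ us′ us Vs′ Vs (sym h) (sym H) (⟦⟧-transport (sym eqᴺ)) (⟦⟧-transport (sym eqᴮ))))
      (⟦⟧-cong (stepᴺ us us′ Vs Vs′ h H (⟦⟧-transport eqᴺ))
               (stepᴺ us′ us Vs′ Vs (sym h) (sym H) (⟦⟧-transport (sym eqᴺ))))
    where
    B N : Vec Word a → Vec Word b → Set
    B us Vs = Before (track s us Vs) (track t us Vs)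
    N us Vs = NonEmpty (track t us Vs)

    tails : ∀ us us′ Vs Vs′ → (N (map tail us) (map tail Vs) → N (map tail us′) (map tail Vs′)) →
            NonEmpty (tail (track t us Vs)) → NonEmpty (tail (track t us′ Vs′))
    tails us us′ Vs Vs′ rec = subst NonEmpty (track-map tail t us′ Vs′) ∘ rec ∘
                              subst NonEmpty (sym (track-map tail t us Vs))

    stepᴺ : ∀ us us′ Vs Vs′ → map head us ≡ map head us′ → map head Vs ≡ map head Vs′ →
            (N (map tail us) (map tail Vs) → N (map tail us′) (map tail Vs′)) →
            N us Vs → N us′ Vs′
    stepᴺ us us′ Vs Vs′ h H rec = NonEmpty-step (track-cong head t h H) (tails us us′ Vs Vs′ rec)

    stepᴮ : ∀ us us′ Vs Vs′ → map head us ≡ map head us′ → map head Vs ≡ map head Vs′ →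
            (N (map tail us) (map tail Vs) → N (map tail us′) (map tail Vs′)) →
            (B (map tail us) (map tail Vs) → B (map tail us′) (map tail Vs′)) →
            B us Vs → B us′ Vs′
    stepᴮ us us′ Vs Vs′ h H recᴺ recᴮ = Before-step (track-cong head s h H) (tails us us′ Vs Vs′ recᴺ)
      (subst₂ Before (track-map tail s us′ Vs′) (track-map tail t us′ Vs′) ∘ recᴮ ∘
       subst₂ Before (sym (track-map tail s us Vs)) (sym (track-map tail t us Vs)))

  project₂ : Congruence a (suc b) → Congruence a b
  project₂ A .size = 2 ^ size A
  project₂ A .τ us Vs = subset (Reachable₂ A us Vs)
  project₂ A .congr us us′ Vs Vs′ h H eq =
    subset-cong (step us us′ Vs Vs′ h H eq) (step us′ us Vs′ Vs (sym h) (sym H) (sym eq))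
    where
    step : ∀ us us′ Vs Vs′ → map head us ≡ map head us′ → map head Vs ≡ map head Vs′ →
           project₂ A .τ (map tail us) (map tail Vs) ≡ project₂ A .τ (map tail us′) (map tail Vs′) →
           ∀ q → Reachable₂ A us Vs q → Reachable₂ A us′ Vs′ q
    step us us′ Vs Vs′ h H eq q (W , refl)
      with W′ , eq′ ← Reachable₂-transport A _ (map tail us′) _ (map tail Vs′) eq (tail W) =
      -- The guess that works for the tails is extended by the letter with which `W` starts.
      head W ∷ W′ , congr A us′ us (_ ∷ Vs′) (W ∷ Vs) (sym h) (cong (head W ∷_) (sym H)) eq′

  -- Besides the states reached by guessing the position of a first-order
  -- variable, remember the state for the track whose position has been passed.

  project₁ : Congruence (suc a) b → Congruence a b
  project₁ A .size = 2 ^ size A * size A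
  project₁ A .τ us Vs = combine (subset (Reachable₁ A us Vs)) (τ A ([] ∷ us) Vs)
  project₁ {a} {b} A .congr us us′ Vs Vs′ h H eq =
    let (eqˢ , eq⁰) = Fin.combine-injective _ (τ A ([] ∷ map tail us) (map tail Vs)) _ _ eq
    in cong₂ combine
      (subset-cong (step us us′ Vs Vs′ h H eqˢ eq⁰)
                   (step us′ us Vs′ Vs (sym h) (sym H) (sym eqˢ) (sym eq⁰)))
      (congr A ([] ∷ us) ([] ∷ us′) Vs Vs′ (cong (false ∷_) h) H eq⁰)
    where
    guess : Vec Word a → Vec Word b → Fin (2 ^ size A)
    guess us Vs = subset (Reachable₁ A us Vs)

    step : ∀ us us′ Vs Vs′ → map head us ≡ map head us′ → map head Vs ≡ map head Vs′ →
           guess (map tail us) (map tail Vs) ≡ guess (map tail us′) (map tail Vs′) →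
           τ A ([] ∷ map tail us) (map tail Vs) ≡ τ A ([] ∷ map tail us′) (map tail Vs′) →
           ∀ q → Reachable₁ A us Vs q → Reachable₁ A us′ Vs′ q
    -- Behind the one of `singleton 0` the guessed track is `[]`, hence the remembered state decides
    -- this case.
    step us us′ Vs Vs′ h H eqˢ eq⁰ q (zero , refl) =
      zero , congr A (singleton 0 ∷ us′) (singleton 0 ∷ us) Vs′ Vs (cong (true ∷_) (sym h)) (sym H) (sym eq⁰)
    step us us′ Vs Vs′ h H eqˢ eq⁰ q (suc x , refl)
      with x′ , eq′ ← Reachable₁-transport A _ (map tail us′) _ (map tail Vs′) eqˢ x =
      suc x′ , congr A (singleton (suc x′) ∷ us′) (singleton (suc x) ∷ us) Vs′ Vs
                 (cong (false ∷_) (sym h)) (sym H) eq′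

  -- From formulas to automata

  automaton : Formula a b → Congruence a b
  automaton (x <ᶠ y) = before (inj₁ x) (inj₁ y)
  automaton (x ≡ᶠ y) = meets (inj₁ x) (inj₁ y)
  automaton (x ∈ᶠ X) = meets (inj₁ x) (inj₂ X)
  automaton (¬ᶠ φ)   = automaton φ
  automaton (φ ∧ᶠ ψ) = automaton φ ⊗ automaton ψ
  automaton (φ ∨ᶠ ψ) = automaton φ ⊗ automaton ψ
  automaton (∃₁ φ)   = project₁ (automaton φ)
  automaton (∀₁ φ)   = project₁ (automaton φ)
  automaton (∃₂ φ)   = project₂ (automaton φ)
  automaton (∀₂ φ)   = project₂ (automaton φ)

  ∈-track : ∀ (xs : Vec ℕ a) x j → j ∈ʷ lookup (map singleton xs) x ⇔ j ≡ lookup xs x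
  ∈-track xs x j rewrite lookup-map x singleton xs =
    mk⇔ (∈-singleton⁻ (lookup xs x) j) λ { refl → ∈-singleton⁺ (lookup xs x) }

  module _ (xs : Vec ℕ a) {Xs : Vec 𝓕 b} {Vs : Vec Word b} (Xs≈Vs : Pointwise _≈_ Xs Vs) where

    Before⇔< : ∀ x y → Before (lookup (map singleton xs) x) (lookup (map singleton xs) y) ⇔
                       lookup xs x < lookup xs y
    Before⇔< x y = mk⇔
      (λ (i , j , i<j , i∈ , j∈) → subst₂ _<_ (to (∈-track xs x i) i∈) (to (∈-track xs y j) j∈) i<j)
      (λ x<y → lookup xs x , lookup xs y , x<y , from (∈-track xs x _) refl , from (∈-track xs y _) refl)

    Meets⇔≡ : ∀ x y → Meets (lookup (map singleton xs) x) (lookup (map singleton xs) y) ⇔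
                      lookup xs x ≡ lookup xs y
    Meets⇔≡ x y = mk⇔
      (λ (j , j∈x , j∈y) → trans (sym (to (∈-track xs x j) j∈x)) (to (∈-track xs y j) j∈y))
      (λ x≡y → lookup xs x , from (∈-track xs x _) refl , from (∈-track xs y _) x≡y)

    Meets⇔∈ : ∀ x X → Meets (lookup (map singleton xs) x) (lookup Vs X) ⇔ lookup xs x ∈ lookup Xs X
    Meets⇔∈ x X = mk⇔
      (λ (j , j∈x , j∈X) → subst (_∈ lookup Xs X) (to (∈-track xs x j) j∈x)
                             (from (Pointwise.lookup Xs≈Vs X j) j∈X))
      (λ x∈X → lookup xs x , from (∈-track xs x _) refl , to (Pointwise.lookup Xs≈Vs X _) x∈X)

  -- Induction on `φ`. An existential witness is carried from the first tuple to the second, an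
  -- instance of a universal quantifier back from the second to the first.
  automaton-sound : ∀ (φ : Formula a b) → Sound (automaton φ) φ
  automaton-sound (x <ᶠ y) xs xs′ Xs≈ Xs′≈ eq =
    to (Before⇔< xs′ Xs′≈ x y) ∘
    ⟦⟧-transport (proj₁ (Fin.combine-injective ⟦ _ ⟧ ⟦ _ ⟧ ⟦ _ ⟧ ⟦ _ ⟧ eq)) ∘
    from (Before⇔< xs Xs≈ x y)
  automaton-sound (x ≡ᶠ y) xs xs′ Xs≈ Xs′≈ eq =
    to (Meets⇔≡ xs′ Xs′≈ x y) ∘ ⟦⟧-transport eq ∘ from (Meets⇔≡ xs Xs≈ x y)
  automaton-sound (x ∈ᶠ X) xs xs′ Xs≈ Xs′≈ eq =
    to (Meets⇔∈ xs′ Xs′≈ x X) ∘ ⟦⟧-transport eq ∘ from (Meets⇔∈ xs Xs≈ x X)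
  automaton-sound (¬ᶠ φ) xs xs′ Xs≈ Xs′≈ eq ¬p p =
    ¬p (automaton-sound φ xs′ xs Xs′≈ Xs≈ (sym eq) p)
  automaton-sound (φ ∧ᶠ ψ) xs xs′ Xs≈ Xs′≈ eq (p , q) =
    let (eq₁ , eq₂) = Fin.combine-injective (τ (automaton φ) _ _) (τ (automaton ψ) _ _) _ _ eq
    in automaton-sound φ xs xs′ Xs≈ Xs′≈ eq₁ p , automaton-sound ψ xs xs′ Xs≈ Xs′≈ eq₂ q
  automaton-sound (φ ∨ᶠ ψ) xs xs′ Xs≈ Xs′≈ eq =
    let (eq₁ , eq₂) = Fin.combine-injective (τ (automaton φ) _ _) (τ (automaton ψ) _ _) _ _ eq
    in Sum.map (automaton-sound φ xs xs′ Xs≈ Xs′≈ eq₁) (automaton-sound ψ xs xs′ Xs≈ Xs′≈ eq₂)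
  automaton-sound (∃₁ φ) xs xs′ {Vs = Vs} {Vs′} Xs≈ Xs′≈ eq (x , p) =
    let (eqˢ , _)  = Fin.combine-injective _ (τ (automaton φ) ([] ∷ map singleton xs) _) _ _ eq
        (x′ , eq′) = Reachable₁-transport (automaton φ) (map singleton xs) (map singleton xs′) Vs Vs′ eqˢ x
    in x′ , automaton-sound φ (x ∷ xs) (x′ ∷ xs′) Xs≈ Xs′≈ (sym eq′) p
  automaton-sound (∀₁ φ) xs xs′ {Vs = Vs} {Vs′} Xs≈ Xs′≈ eq p x′ =
    let (eqˢ , _) = Fin.combine-injective _ (τ (automaton φ) ([] ∷ map singleton xs) _) _ _ eq
        (x , eq′) = Reachable₁-transport (automaton φ) (map singleton xs′) (map singleton xs) Vs′ Vs (sym eqˢ) x′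
    in automaton-sound φ (x ∷ xs) (x′ ∷ xs′) Xs≈ Xs′≈ eq′ (p x)
  automaton-sound (∃₂ φ) xs xs′ {Vs = Vs} {Vs′} Xs≈ Xs′≈ eq (X , p) =
    let (W′ , eq′) = Reachable₂-transport (automaton φ) (map singleton xs) (map singleton xs′) Vs Vs′ eq (toWord X)
    in fromWord 0 W′ , automaton-sound φ xs xs′ (≈toWord X ∷ Xs≈) (fromWord≈ W′ ∷ Xs′≈) (sym eq′) p
  automaton-sound (∀₂ φ) xs xs′ {Vs = Vs} {Vs′} Xs≈ Xs′≈ eq p X′ =
    let (W , eq′) = Reachable₂-transport (automaton φ) (map singleton xs′) (map singleton xs) Vs′ Vs (sym eq) (toWord X′)
    in automaton-sound φ xs xs′ (fromWord≈ W ∷ Xs≈) (≈toWord X′ ∷ Xs′≈) eq′ (p (fromWord 0 W))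

-- Successors and ranks inside a finite set

Least : Pred ℕ 0ℓ → Pred ℕ 0ℓ
Least P y = P y × (∀ u → ¬ (P u × u < y))

Least-unique : ∀ {P x y} → Least P x → Least P y → x ≡ y
Least-unique {x = x} {y} (px , x≤) (py , y≤) with <-cmp x y
... | tri< x<y _ _ = contradiction (px , x<y) (y≤ x)
... | tri≈ _ x≡y _ = x≡y
... | tri> _ _ y<x = contradiction (py , y<x) (x≤ y)

above : ℕ → Word → Word
above zero    W = tail W
above (suc z) W = above z (tail W)

∈-above : ∀ z W j → (j ∈ʷ above z W) ≡ (suc (z + j) ∈ʷ W)
∈-above zero    W j = refl
∈-above (suc z) W j = ∈-above z (tail W) j

above-above : ∀ z W j → above j (above z W) ≡ above (suc (z + j)) W
above-above zero    W j = refl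
above-above (suc z) W j = above-above z (tail W) j

count-least : ∀ W {m} → count W ≡ suc m → ∃[ j ] Least (_∈ʷ W) j × count (above j W) ≡ m
count-least (true ∷ W)  eq = 0 , (refl , λ { _ (_ , ()) }) , suc-injective eq
count-least (false ∷ W) eq with j , (j∈ , j≤) , eq′ ← count-least W eq =
  suc j , (j∈ , λ { (suc u) (u∈ , s≤s u<j) → j≤ u (u∈ , u<j) }) , eq′

count≡0⇒∉ : ∀ W j → count W ≡ 0 → ¬ j ∈ʷ W
count≡0⇒∉ []          j       eq = ∉ʷ[] j
count≡0⇒∉ (false ∷ W) (suc j) eq = count≡0⇒∉ W j eq

∈ʷ⇒<length : ∀ W j → j ∈ʷ W → j < length W
∈ʷ⇒<length []      j       j∈ = contradiction j∈ (∉ʷ[] j)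
∈ʷ⇒<length (b ∷ W) zero    j∈ = s≤s z≤n
∈ʷ⇒<length (b ∷ W) (suc j) j∈ = s≤s (∈ʷ⇒<length W j j∈)

-- The negated conjunctions in `Least` and `Last` make `First`, `Next` and `Last` agree
-- definitionally with the semantics of `firstF`, `nextF` and `lastF`.
First : 𝓕 → Pred ℕ 0ℓ
First X = Least (_∈ X)

Next : 𝓕 → ℕ → Pred ℕ 0ℓ
Next X x = Least λ y → y ∈ X × x < y

Last : 𝓕 → Pred ℕ 0ℓ
Last X x = ∀ u → ¬ (u ∈ X × x < u)

Steps : ℕ → 𝓕 → ℕ → Pred ℕ 0ℓ
Steps zero    X x y = x ≡ y
Steps (suc k) X x y = ∃[ u ] Next X x u × Steps k X u y

Steps⇒∈ : ∀ k {X x y} → Steps k X x y → x ≡ y ⊎ y ∈ X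
Steps⇒∈ zero    eq = inj₁ eq
Steps⇒∈ (suc k) (u , ((u∈ , _) , _) , steps) with Steps⇒∈ k steps
... | inj₁ refl = inj₂ u∈
... | inj₂ y∈   = inj₂ y∈

module _ (X : 𝓕) where

  private
    W = toWord X

  -- The number of elements of `X` beyond `z`. Each successor step lowers it by one, and it is 0
  -- where nothing follows.
  rank : ℕ → ℕ
  rank z = count (above z W)

  ∈-above⁺ : ∀ {z u} → u ∈ X → z < u → ∃[ j ] j ∈ʷ above z W × u ≡ suc (z + j)
  ∈-above⁺ {z} {u} u∈ z<u with m≤n⇒∃[o]m+o≡n z<u
  ... | j , refl = j , subst id (sym (∈-above z W j)) (to (≈toWord X u) u∈) , refl

  ∈-above⁻ : ∀ {z j} → j ∈ʷ above z W → suc (z + j) ∈ X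
  ∈-above⁻ {z} {j} j∈ = from (≈toWord X _) (subst id (∈-above z W j) j∈)

  First-exists : ∀ {m} → ∣ X ∣ ≡ suc m → ∃[ z ] First X z × rank z ≡ m
  First-exists eq with j , (j∈ , j≤) , eq′ ← count-least W (trans (count-toWord X) eq) =
    j , (from (≈toWord X j) j∈ , λ u (u∈ , u<j) → j≤ u (to (≈toWord X u) u∈ , u<j)) , eq′

  Next-exists : ∀ {z m} → rank z ≡ suc m → ∃[ z′ ] Next X z z′ × rank z′ ≡ m
  Next-exists {z} eq with j , (j∈ , j≤) , eq′ ← count-least (above z W) eq =
    suc (z + j) , ((∈-above⁻ {z} {j} j∈ , s≤s (m≤m+n z j)) , least) ,
    trans (sym (cong count (above-above z W j))) eq′
    where
    least : ∀ u → ¬ ((u ∈ X × z < u) × u < suc (z + j))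
    least u ((u∈ , z<u) , s≤s u≤) with i , i∈ , refl ← ∈-above⁺ u∈ z<u =
      j≤ i (i∈ , +-cancelˡ-< z i j u≤)

  -- Existence yields a first element of known rank, and uniqueness identifies it with `z`.
  -- `rank-Next` works in the same way.
  rank-First : ∀ {z} → First X z → ∣ X ∣ ≡ suc (rank z)
  rank-First {z} first with ∣ X ∣ in eq
  ... | zero  = contradiction (to (≈toWord X z) (proj₁ first)) (count≡0⇒∉ W z (trans (count-toWord X) eq))
  ... | suc m with z′ , first′ , eq′ ← First-exists eq
    with refl ← Least-unique first first′ = cong suc (sym eq′)

  rank-Next : ∀ {z z′} → Next X z z′ → rank z ≡ suc (rank z′)
  rank-Next {z} next@((z′∈ , z<z′) , _) with rank z in eq
  ... | zero  = let (j , j∈ , _) = ∈-above⁺ z′∈ z<z′ in contradiction j∈ (count≡0⇒∉ _ j eq)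
  ... | suc m with z″ , next′ , eq′ ← Next-exists eq
    with refl ← Least-unique next next′ = cong suc (sym eq′)

  rank-Last : ∀ {z} → Last X z ⇔ rank z ≡ 0
  rank-Last {z} = mk⇔ ⇒ λ eq u (u∈ , z<u) →
    let (j , j∈ , _) = ∈-above⁺ u∈ z<u in count≡0⇒∉ _ j eq j∈
    where
    ⇒ : Last X z → rank z ≡ 0
    ⇒ last with rank z in eq
    ... | zero  = refl
    ... | suc m with z′ , ((z′∈ , z<z′) , _) , _ ← Next-exists eq = contradiction (z′∈ , z<z′) (last z′)

  rank-Steps : ∀ k {z z′} → Steps k X z z′ → rank z ≡ k + rank z′
  rank-Steps zero    refl               = refl
  rank-Steps (suc k) (u , next , steps) = trans (rank-Next next) (cong suc (rank-Steps k steps))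

  Steps-exists : ∀ k {z m} → rank z ≡ k + m → ∃[ z′ ] Steps k X z z′ × rank z′ ≡ m
  Steps-exists zero    eq = _ , refl , eq
  Steps-exists (suc k) eq with u , next , eq₁ ← Next-exists eq
    with z′ , steps , eq₂ ← Steps-exists k eq₁ = z′ , (u , next , steps) , eq₂

-- A trap witnesses that p-fold successor steps in X do not lead from z to the
-- last element of X.

Trap : ℕ → 𝓕 → Pred ℕ 0ℓ
Trap p X z = Σ[ C ∈ 𝓕 ] z ∈ C ×
  (∀ u v → ¬ (u ∈ C × Steps p X u v × ¬ v ∈ C)) × (∀ v → ¬ (v ∈ C × Last X v))

-- Following `p` steps `k` times, a closed set that contains `z` arrives at a number of rank 0,
-- which is last.
¬Trap : ∀ p X z k → rank X z ≡ k * p → ¬ Trap p X z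
¬Trap p X z zero    eq (C , z∈ , _      , noLast) = noLast z (z∈ , from (rank-Last X) eq)
¬Trap p X z (suc k) eq (C , z∈ , closed , noLast) with v , steps , eq′ ← Steps-exists X p eq =
  closed z v (z∈ , steps , λ v∈ → ¬Trap p X v k eq′ (C , v∈ , closed , noLast))

-- Formulas for cardinalities in a progression

firstF lastF : Fin b → Fin a → Formula a b
firstF X z = z ∈ᶠ X ∧ᶠ ∀₁ (¬ᶠ (zero ∈ᶠ X ∧ᶠ zero <ᶠ suc z))
lastF  X z = ∀₁ (¬ᶠ (zero ∈ᶠ X ∧ᶠ suc z <ᶠ zero))

nextF : Fin b → Fin a → Fin a → Formula a b
nextF X x y = (y ∈ᶠ X ∧ᶠ x <ᶠ y) ∧ᶠ ∀₁ (¬ᶠ ((zero ∈ᶠ X ∧ᶠ suc x <ᶠ zero) ∧ᶠ zero <ᶠ suc y))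

stepsF : ℕ → Fin b → Fin a → Fin a → Formula a b
stepsF zero    X x y = x ≡ᶠ y
stepsF (suc k) X x y = ∃₁ (nextF X (suc x) zero ∧ᶠ stepsF k X zero (suc y))

trapF : ℕ → Fin b → Fin a → Formula a b
trapF p X z = ∃₂ (z ∈ᶠ zero
  ∧ᶠ ∀₁ (∀₁ (¬ᶠ (suc zero ∈ᶠ zero ∧ᶠ stepsF p (suc X) (suc zero) zero ∧ᶠ ¬ᶠ (zero ∈ᶠ zero))))
  ∧ᶠ ∀₁ (¬ᶠ (zero ∈ᶠ zero ∧ᶠ lastF (suc X) zero)))

-- The first element has rank |X| - 1, and `c` steps later the rank is |X| - 1 - c. Having no trap
-- there means that this rank is a multiple of `p`, so |X| lies in the progression that starts at
-- `suc c`.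
progressionF : ℕ → ℕ → Fin b → Formula a b
progressionF c p X = ∃₁ (firstF X zero ∧ᶠ ∃₁ (stepsF c X (suc zero) zero ∧ᶠ ¬ᶠ trapF p X zero))

stepsF⇔ : ∀ k (X : Fin b) (x y : Fin a) xs Xs →
          (⟨ℕ,<⟩⊨ stepsF k X x y [ xs , Xs ]) ⇔ Steps k (lookup Xs X) (lookup xs x) (lookup xs y)
stepsF⇔ zero    X x y xs Xs = mk⇔ id id
stepsF⇔ (suc k) X x y xs Xs = mk⇔
  (λ (u , next , steps) → u , next , to   (stepsF⇔ k X zero (suc y) (u ∷ xs) Xs) steps)
  (λ (u , next , steps) → u , next , from (stepsF⇔ k X zero (suc y) (u ∷ xs) Xs) steps)

trapF⇔ : ∀ p (X : Fin b) (z : Fin a) xs Xs →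
         (⟨ℕ,<⟩⊨ trapF p X z [ xs , Xs ]) ⇔ Trap p (lookup Xs X) (lookup xs z)
trapF⇔ p X z xs Xs = mk⇔
  (λ (C , z∈ , closed , noLast) → C , z∈ , (λ u v (u∈ , steps , v∉) →
    closed u v (u∈ , from (stepsF⇔ p (suc X) (suc zero) zero (v ∷ u ∷ xs) (C ∷ Xs)) steps , v∉)) , noLast)
  (λ (C , z∈ , closed , noLast) → C , z∈ , (λ u v (u∈ , steps , v∉) →
    closed u v (u∈ , to (stepsF⇔ p (suc X) (suc zero) zero (v ∷ u ∷ xs) (C ∷ Xs)) steps , v∉)) , noLast)

definable-resp : {R S : Pred (Vec 𝓕 n) 0ℓ} → (∀ Xs → R Xs ⇔ S Xs) → Definable R → Definable S
definable-resp eq (φ , ⇔φ) = φ , λ Xs → mk⇔ (to (⇔φ Xs) ∘ from (eq Xs)) (to (eq Xs) ∘ from (⇔φ Xs))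

definable-× : {R S : Pred (Vec 𝓕 n) 0ℓ} → Definable R → Definable S → Definable λ Xs → R Xs × S Xs
definable-× (φ , ⇔φ) (ψ , ⇔ψ) = (φ ∧ᶠ ψ) , λ Xs → mk⇔
  (Product.map (to (⇔φ Xs)) (to (⇔ψ Xs))) (Product.map (from (⇔φ Xs)) (from (⇔ψ Xs)))

definable-⊎ : {R S : Pred (Vec 𝓕 n) 0ℓ} → Definable R → Definable S → Definable λ Xs → R Xs ⊎ S Xs
definable-⊎ (φ , ⇔φ) (ψ , ⇔ψ) = (φ ∨ᶠ ψ) , λ Xs → mk⇔
  (Sum.map (to (⇔φ Xs)) (to (⇔ψ Xs))) (Sum.map (from (⇔φ Xs)) (from (⇔ψ Xs)))

-- Definability of progressions and finite Boolean combinations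

module _ (em : ExcludedMiddle 0ℓ) where

  comprehension : ∀ (P : Pred ℕ 0ℓ) N → ∃[ W ] (∀ j → j ∈ʷ W ⇔ (j < N × P j))
  comprehension P zero    = [] , λ j → mk⇔ (λ j∈ → contradiction j∈ (∉ʷ[] j)) λ { (() , _) }
  comprehension P (suc N) with W , ⇔W ← comprehension (P ∘ suc) N with em {P 0}
  ... | yes p = true ∷ W , λ
    { zero    → mk⇔ (λ _ → s≤s z≤n , p) (λ _ → refl)
    ; (suc j) → mk⇔ (Product.map₁ s≤s ∘ to (⇔W j)) λ { (s≤s j<N , q) → from (⇔W j) (j<N , q) } }
  ... | no ¬p = false ∷ W , λ
    { zero    → mk⇔ (λ ()) λ (_ , p) → contradiction p ¬p
    ; (suc j) → mk⇔ (Product.map₁ s≤s ∘ to (⇔W j)) λ { (s≤s j<N , q) → from (⇔W j) (j<N , q) } }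

  -- The trap collects the numbers whose rank differs from that of `z` by a multiple of `p`. A last
  -- member would have rank 0 and make `rank X z` itself such a multiple.
  Trap-exists : ∀ p X z → ¬ (∃[ k ] rank X z ≡ k * p) → Trap p X z
  Trap-exists p X z ¬k = fromWord 0 V , ∈C (m≤m+n (suc z) _) (0 , refl) , closed , noLast
    where
    -- The cut-off lies beyond `z` and beyond all elements of `X`, so successor steps cannot leave
    -- the bounded range.
    N = suc z + length (toWord X)

    Q : Pred ℕ 0ℓ
    Q u = ∃[ k ] rank X z ≡ k * p + rank X u

    V = proj₁ (comprehension Q N)

    ∈C : ∀ {u} → u < N → Q u → u ∈ fromWord 0 V
    ∈C u<N q = from (fromWord≈ V _) (from (proj₂ (comprehension Q N) _) (u<N , q))

    C∋ : ∀ {u} → u ∈ fromWord 0 V → u < N × Q u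
    C∋ u∈ = to (proj₂ (comprehension Q N) _) (to (fromWord≈ V _) u∈)

    bound : ∀ {u v} → Steps p X u v → u < N → v < N
    bound steps u<N with Steps⇒∈ p steps
    ... | inj₁ refl = u<N
    ... | inj₂ v∈   = ≤-trans (∈ʷ⇒<length _ _ (to (≈toWord X _) v∈)) (m≤n+m _ (suc z))

    closed : ∀ u v → ¬ (u ∈ fromWord 0 V × Steps p X u v × ¬ v ∈ fromWord 0 V)
    closed u v (u∈ , steps , v∉) with u<N , k , eq ← C∋ u∈ =
      v∉ (∈C (bound steps u<N) (suc k , trans eq (trans (cong (k * p +_) (rank-Steps X p steps))
        (trans (sym (+-assoc (k * p) p _)) (cong (_+ rank X v) (+-comm (k * p) p))))))

    noLast : ∀ v → ¬ (v ∈ fromWord 0 V × Last X v)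
    noLast v (v∈ , last) with _ , k , eq ← C∋ v∈ =
      ¬k (k , trans eq (trans (cong (k * p +_) (to (rank-Last X) last)) (+-identityʳ _)))

  definable-progression⁺ : ∀ (i : Fin n) c p →
    Definable λ Xs → ∃[ k ] ∣ lookup Xs i ∣ ≡ suc c + k * p
  definable-progression⁺ i c p = progressionF c p i , λ Xs → mk⇔ (⇒ Xs) (⇐ Xs)
    where
    ⇒ : ∀ Xs → ∃[ k ] ∣ lookup Xs i ∣ ≡ suc c + k * p → ⟨ℕ,<⟩⊨ progressionF c p i [ [] , Xs ]
    ⇒ Xs (k , eq) with f , first , eq₁ ← First-exists (lookup Xs i) eq
      with z , steps , eq₂ ← Steps-exists (lookup Xs i) c eq₁ =
      f , first , z , from (stepsF⇔ c i (suc zero) zero (z ∷ f ∷ []) Xs) steps ,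
      ¬Trap p (lookup Xs i) z k eq₂ ∘ to (trapF⇔ p i zero (z ∷ f ∷ []) Xs)

    ⇐ : ∀ Xs → ⟨ℕ,<⟩⊨ progressionF c p i [ [] , Xs ] → ∃[ k ] ∣ lookup Xs i ∣ ≡ suc c + k * p
    ⇐ Xs (f , first , z , steps , ¬trap) with em {∃[ k ] rank (lookup Xs i) z ≡ k * p}
    ... | no ¬k = contradiction
      (from (trapF⇔ p i zero (z ∷ f ∷ []) Xs) (Trap-exists p (lookup Xs i) z ¬k)) ¬trap
    ... | yes (k , eq) = k , trans (rank-First (lookup Xs i) first) (cong suc
      (trans (rank-Steps (lookup Xs i) c (to (stepsF⇔ c i (suc zero) zero (z ∷ f ∷ []) Xs) steps))
             (cong (c +_) eq)))

  definable-empty : ∀ (i : Fin n) → Definable λ Xs → ∣ lookup Xs i ∣ ≡ 0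
  definable-empty i = ∀₁ (¬ᶠ (zero ∈ᶠ i)) , λ Xs → mk⇔
    (λ eq x x∈ → count≡0⇒∉ _ x (trans (count-toWord (lookup Xs i)) eq) (to (≈toWord (lookup Xs i) x) x∈))
    (⇐ Xs)
    where
    ⇐ : ∀ Xs → (∀ x → ¬ x ∈ lookup Xs i) → ∣ lookup Xs i ∣ ≡ 0
    ⇐ Xs ∉ with ∣ lookup Xs i ∣ in eq
    ... | zero  = refl
    ... | suc m with z , first , _ ← First-exists (lookup Xs i) eq = contradiction (proj₁ first) (∉ z)

  definable-progression : ∀ (i : Fin n) c p → Definable λ Xs → ∃[ k ] ∣ lookup Xs i ∣ ≡ c + k * p
  definable-progression i (suc c) p    = definable-progression⁺ i c p
  -- `progressionF` starts from a first element and so only describes nonempty sets. For `c = 0` the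
  -- empty set is added by hand, and the other members of the progression start at `suc p`.
  definable-progression i zero zero    = definable-resp
    (λ Xs → mk⇔ (λ eq → 0 , eq) (λ (k , eq) → trans eq (*-zeroʳ k))) (definable-empty i)
  definable-progression i zero (suc p) = definable-resp
    (λ Xs → mk⇔ (λ { (inj₁ eq) → 0 , eq ; (inj₂ (k , eq)) → suc k , eq })
                (λ { (zero , eq) → inj₁ eq ; (suc k , eq) → inj₂ (k , eq) }))
    (definable-⊎ (definable-empty i) (definable-progression⁺ i p (suc p)))

  -- Excluded middle picks a true or a false sentence. This will select the residue classes and the
  -- boxes that contribute to a union.
  definable-const : (P : Set) → Definable {n} λ _ → P
  definable-const P with em {P}
  ... | yes p = ∀₁ (zero ≡ᶠ zero) , λ Xs → mk⇔ (λ _ _ → refl) (λ _ → p)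
  ... | no ¬p = ∃₁ (zero <ᶠ zero) , λ Xs → mk⇔ (λ p → contradiction p ¬p)
                                               (λ (_ , lt) → contradiction lt (<-irrefl refl))

  definable-∃ : ∀ {k} {R : Fin k → Pred (Vec 𝓕 n) 0ℓ} → (∀ l → Definable (R l)) →
                Definable λ Xs → ∃[ l ] R l Xs
  definable-∃ {k = zero}  defs = definable-resp (λ Xs → mk⇔ (λ ()) λ ()) (definable-const (Fin 0))
  definable-∃ {k = suc k} defs = definable-resp
    (λ Xs → mk⇔ (λ { (inj₁ r) → zero , r ; (inj₂ (l , r)) → suc l , r })
                (λ { (zero , r) → inj₁ r ; (suc l , r) → inj₂ (l , r) }))
    (definable-⊎ (defs zero) (definable-∃ (defs ∘ suc)))

  definable-∀ : ∀ {k} {R : Fin k → Pred (Vec 𝓕 n) 0ℓ} → (∀ l → Definable (R l)) →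
                Definable λ Xs → ∀ l → R l Xs
  definable-∀ {k = zero}  defs =
    definable-resp (λ Xs → mk⇔ (λ _ ()) (λ _ → refl)) (definable-const (0 ≡ 0))
  definable-∀ {k = suc k} defs = definable-resp
    (λ Xs → mk⇔ (λ { (r , rs) zero → r ; (r , rs) (suc l) → rs l }) (λ rs → rs zero , rs ∘ suc))
    (definable-× (defs zero) (definable-∀ (defs ∘ suc)))

≡⇒⇔ : ∀ {A : Set} (P : Pred A 0ℓ) {x y} → x ≡ y → P x ⇔ P y
≡⇒⇔ P refl = ⇔.refl

-- Common periods and residue classes

Periodic : ℕ → ℕ → Pred ℕ 0ℓ → Set
Periodic M p P = ∀ x → x ≥ M → P x ⇔ P (x + p)

Periodic-* : ∀ {M p P} k → Periodic M p P → Periodic M (k * p) P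
Periodic-*         {P = P} zero    per x x≥M = ≡⇒⇔ P (sym (+-identityʳ x))
Periodic-* {p = p} {P}     (suc k) per x x≥M = ⇔.trans (per x x≥M)
  (⇔.trans (Periodic-* k per (x + p) (≤-trans x≥M (m≤m+n x p))) (≡⇒⇔ P (+-assoc x p (k * p))))

UniformlyPeriodic : ∀ {I : Set} → (I → Pred ℕ 0ℓ) → Set
UniformlyPeriodic F = ∃[ M ] ∃[ p ] p ≥ 1 × (∀ ι → Periodic M p (F ι))

-- Finitely many families share the maximum of their thresholds and the product of their periods;
-- each single family may be infinite.
UniformlyPeriodic-∀ : ∀ {k} {I : Fin k → Set} {F : ∀ l → I l → Pred ℕ 0ℓ} →
  (∀ l → UniformlyPeriodic (F l)) → UniformlyPeriodic {Σ[ l ∈ Fin k ] I l} λ (l , ι) → F l ι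
UniformlyPeriodic-∀ {zero}  per = 0 , 1 , ≤-refl , λ ()
UniformlyPeriodic-∀ {suc k} {F = F} per
  with M , p , p≥1 , h ← per zero | M′ , p′ , p′≥1 , h′ ← UniformlyPeriodic-∀ (per ∘ suc) =
  M ⊔ M′ , p * p′ , *-mono-≤ p≥1 p′≥1 , λ
    { (zero , ι)  x x≥ → subst (λ q → F zero ι x ⇔ F zero ι (x + q)) (*-comm p′ p)
                           (Periodic-* p′ (h ι) x (m⊔n≤o⇒m≤o M M′ x≥))
    ; (suc l , ι) x x≥ → Periodic-* p (h′ (l , ι)) x (m⊔n≤o⇒n≤o M M′ x≥) }

upperBound : ∀ {k} (f : Fin k → ℕ) → ∃[ N ] (∀ i → f i ≤ N)
upperBound {zero}  f = 0 , λ ()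
upperBound {suc k} f with N , f≤N ← upperBound (f ∘ suc) =
  f zero ⊔ N , λ { zero → m≤m⊔n _ N ; (suc i) → ≤-trans (f≤N i) (m≤n⊔m (f zero) N) }

-- Modulo threshold M and period p, every number is in the progression
-- c + period M p c * ℕ of some c < M + p.

period : ℕ → ℕ → ℕ → ℕ
period M p c with c <? M
... | yes _ = 0
... | no  _ = p

-- For `q = 0` this is the singleton of `c`, so points below a threshold and residue classes above
-- it have the same form.
Progression : ℕ → ℕ → Pred ℕ 0ℓ
Progression c q x = ∃[ k ] x ≡ c + k * q

Progression-ultimatelyPeriodic : ∀ c q → UltimatelyPeriodic (Progression c q)
-- Beyond `c` both sides are false, so the period 1 works.
Progression-ultimatelyPeriodic c zero = suc c , 1 , ≤-refl , λ x x>c → mk⇔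
  (λ (k , eq) → contradiction x>c (≤⇒≯ (≤-reflexive (x≡c k eq))))
  (λ (k , eq) → contradiction x>c (≤⇒≯ (≤-trans (m≤m+n x 1) (≤-reflexive (x≡c k eq)))))
  where
  x≡c : ∀ {x} k → x ≡ c + k * 0 → x ≡ c
  x≡c k eq = trans eq (trans (cong (c +_) (*-zeroʳ k)) (+-identityʳ c))
Progression-ultimatelyPeriodic c q@(suc _) = c , q , s≤s z≤n , λ x x≥c → mk⇔
  (λ { (k , refl) → suc k , trans (+-assoc c (k * q) q) (cong (c +_) (+-comm (k * q) q)) })
  (λ { (zero , eq)  → contradiction
         (≤-trans (+-monoˡ-≤ q x≥c) (≤-reflexive (trans eq (+-identityʳ c)))) (m+1+n≰m c)
     ; (suc k , eq) → k , +-cancelʳ-≡ q x (c + k * q)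
         (trans eq (trans (cong (c +_) (+-comm q (k * q))) (sym (+-assoc c (k * q) q)))) })

representative : ∀ M p → p ≥ 1 → ∀ x → ∃[ c ] Progression (toℕ {M + p} c) (period M p (toℕ c)) x
representative M p p≥1 x with x <? M
... | yes x<M = fromℕ< (≤-trans x<M (m≤m+n M p)) , 0 ,
  sym (trans (+-identityʳ _) (Fin.toℕ-fromℕ< _))
-- Above the threshold the representative is `M` plus the remainder of `x ∸ M` modulo `p`.
... | no  x≮M = fromℕ< (+-monoʳ-< M (m%n<n (x ∸ M) p)) , (x ∸ M) / p ,
  subst (λ c → Progression′ c) (sym (Fin.toℕ-fromℕ< _)) eq
  where
  instance _ = >-nonZero p≥1

  Progression′ : Pred ℕ 0ℓ
  Progression′ c = x ≡ c + (x ∸ M) / p * period M p c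

  eq : Progression′ (M + (x ∸ M) % p)
  eq with M + (x ∸ M) % p <? M
  ... | yes lt = contradiction lt (m+n≮m M _)
  ... | no _   = trans (sym (m+[n∸m]≡n (≮⇒≥ x≮M)))
    (trans (cong (M +_) (m≡m%n+[m/n]*n (x ∸ M) p)) (sym (+-assoc M _ _)))

Periodic⇒⇔ : ∀ {M p P c x} → Periodic M p P → Progression c (period M p c) x → P c ⇔ P x
Periodic⇒⇔ {M} {p} {P} {c} per (k , refl) with c <? M
... | yes _  = ≡⇒⇔ P (sym (trans (cong (c +_) (*-zeroʳ k)) (+-identityʳ c)))
... | no c≮M = Periodic-* k per c (≮⇒≥ c≮M)

-- Along each axis one threshold and one period hold for all values of the other coordinates, small
-- ones included; this is what distinguishes it from strong ultimate periodicity.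
AxisPeriodic : Pred (Vec ℕ n) 0ℓ → Set
AxisPeriodic S = ∀ j → UniformlyPeriodic λ xs x → S (xs [ j ]≔ x)

-- Coordinates are exchanged one at a time, the head last. The mixed tuples in between are covered
-- because `per` holds for all of them.
AxisPeriodic⇒⇔ : ∀ {M p} (S : Pred (Vec ℕ n) 0ℓ) →
  (∀ j xs → Periodic M p λ x → S (xs [ j ]≔ x)) →
  ∀ cs xs → (∀ i → Progression (lookup cs i) (period M p (lookup cs i)) (lookup xs i)) → S cs ⇔ S xs
AxisPeriodic⇒⇔ S per []       []       _ = ⇔.refl
AxisPeriodic⇒⇔ S per (c ∷ cs) (x ∷ xs) r = ⇔.trans
  (AxisPeriodic⇒⇔ (S ∘ (c ∷_)) (λ j ys → per (suc j) (c ∷ ys)) cs xs (r ∘ suc))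
  (Periodic⇒⇔ {P = λ y → S (y ∷ xs)} (per zero (x ∷ xs)) (r zero))

AxisPeriodic⇒Recognizable : (S : Pred (Vec ℕ (suc n)) 0ℓ) → AxisPeriodic S → Recognizable S
AxisPeriodic⇒Recognizable {n} S axis with M , p , p≥1 , per ← UniformlyPeriodic-∀ axis =
  -- There is one box for each tuple of representatives. The condition `S (reps l)` is part of every
  -- side, which empties the boxes outside `S`; it is read off at side `zero`, which exists in
  -- positive dimension.
  (M + p) ^ suc n , (λ l i x → S (reps l) × Class l i x) ,
  (λ l i → ultimatelyPeriodic-× (Progression-ultimatelyPeriodic _ _)) ,
  λ xs → mk⇔ (⇒ xs) λ (l , h) → to (resp l xs (proj₂ ∘ h)) (proj₁ (h zero))
  where
  N = M + p

  residue : Fin (N ^ suc n) → Fin (suc n) → ℕ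
  residue l = toℕ ∘ finToFun {N} {suc n} l

  reps : Fin (N ^ suc n) → Vec ℕ (suc n)
  reps l = tabulate (residue l)

  Class : Fin (N ^ suc n) → Fin (suc n) → Pred ℕ 0ℓ
  Class l i = Progression (residue l i) (period M p (residue l i))

  ultimatelyPeriodic-× : ∀ {P : Set} {E} → UltimatelyPeriodic E → UltimatelyPeriodic λ x → P × E x
  ultimatelyPeriodic-× (M , p , p≥1 , h) = M , p , p≥1 , λ x x≥M → mk⇔
    (λ (q , e) → q , to (h x x≥M) e) (λ (q , e) → q , from (h x x≥M) e)

  resp : ∀ l xs → (∀ i → Class l i (lookup xs i)) → S (reps l) ⇔ S xs
  resp l xs cls = AxisPeriodic⇒⇔ S (λ j ys → per (j , ys)) (reps l) xs
    λ i → subst (λ c → Progression c (period M p c) (lookup xs i)) (sym (lookup∘tabulate (residue l) i)) (cls i)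

  ⇒ : ∀ xs → S xs → ∃[ l ] (∀ i → S (reps l) × Class l i (lookup xs i))
  ⇒ xs s = l , λ i → from (resp l xs cls) s , cls i
    where
    cs : Fin (suc n) → Fin N
    cs i = proj₁ (representative M p p≥1 (lookup xs i))
    l = funToFin cs
    cls : ∀ i → Class l i (lookup xs i)
    cls i = subst (λ c → Progression (toℕ c) (period M p (toℕ c)) (lookup xs i))
      (sym (Fin.finToFun-funToFin cs i)) (proj₂ (representative M p p≥1 (lookup xs i)))

-- Consequences of recognizability

module _ (em : ExcludedMiddle 0ℓ) where

  -- An ultimately periodic set is the union of the finitely many progressions whose representative
  -- belongs to it.
  definable-card∈ : ∀ {E} → UltimatelyPeriodic E → (i : Fin n) → Definable λ Xs → E ∣ lookup Xs i ∣
  definable-card∈ {E = E} (M , p , p≥1 , per) i = definable-resp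
    (λ Xs → mk⇔
      (λ (c , e , prog) → to (Periodic⇒⇔ per prog) e)
      (λ e → let (c , prog) = representative M p p≥1 ∣ lookup Xs i ∣
             in c , from (Periodic⇒⇔ per prog) e , prog))
    (definable-∃ em {k = M + p} λ c → definable-× (definable-const em (E (toℕ c)))
      (definable-progression em i (toℕ c) (period M p (toℕ c))))

  Recognizable⇒Definable : (S : Pred (Vec ℕ n) 0ℓ) → Recognizable S → Definable (𝓒 S)
  Recognizable⇒Definable S (k , E , per , ⇔E) = definable-resp
    (λ Xs → ⇔.trans (mk⇔
      (λ (l , h) → l , λ i → subst (E l i) (sym (lookup-map i ∣_∣ Xs)) (h i))
      (λ (l , h) → l , λ i → subst (E l i) (lookup-map i ∣_∣ Xs) (h i)))
      (⇔.sym (⇔E (map ∣_∣ Xs))))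
    (definable-∃ em λ l → definable-∀ em λ i → definable-card∈ (per l i) i)

  Recognizable⇒Section-Definable : (S : Pred (Vec ℕ (suc n)) 0ℓ) → Recognizable S →
                                   ∀ i C → Definable (𝓒 (Section S i C))
  Recognizable⇒Section-Definable S (k , E , per , ⇔E) i C = definable-resp
    (λ Xs → ⇔.trans (mk⇔
      (λ (l , e , h) → l , λ j → glue Xs l j e h)
      (λ (l , h) → l , subst (E l i) (insertAt-lookup (map ∣_∣ Xs) i C) (h i) , λ j →
        subst (E l (punchIn i j)) (trans (insertAt-punchIn (map ∣_∣ Xs) i C j) (lookup-map j ∣_∣ Xs))
              (h (punchIn i j))))
      (⇔.sym (⇔E (insertAt (map ∣_∣ Xs) i C))))
    (definable-∃ em λ l → definable-× (definable-const em (E l i C))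
      (definable-∀ em λ j → definable-card∈ (per l (punchIn i j)) j))
    where
    glue : ∀ Xs l j → E l i C → (∀ j → E l (punchIn i j) ∣ lookup Xs j ∣) →
           E l j (lookup (insertAt (map ∣_∣ Xs) i C) j)
    glue Xs l j e h with i Fin.≟ j
    ... | yes refl = subst (E l i) (sym (insertAt-lookup (map ∣_∣ Xs) i C)) e
    ... | no i≢j with j′ ← punchOut i≢j | refl ← Fin.punchIn-punchOut i≢j = subst (E l (punchIn i j′))
      (sym (trans (insertAt-punchIn (map ∣_∣ Xs) i C j′) (lookup-map j′ ∣_∣ Xs))) (h j′)

Definable⇒CardDefinable : (S : Pred (Vec ℕ n) 0ℓ) → Definable (𝓒 S) → CardDefinable S
Definable⇒CardDefinable {zero}  S def = tt
Definable⇒CardDefinable {suc n} S def = def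

Recognizable⇒StronglyUltimatelyPeriodic : (S : Pred (Vec ℕ n) 0ℓ) → Recognizable S →
                                          StronglyUltimatelyPeriodic S
Recognizable⇒StronglyUltimatelyPeriodic {n} S (k , E , per , ⇔E) =
  m , p , p≥1 , λ xs xs≥m j → ⇔.trans (⇔E xs) (⇔.trans (mk⇔
    (λ (l , h) → l , λ i → to   (shift l xs j (≤-trans (M≤m j) (xs≥m j)) i) (h i))
    (λ (l , h) → l , λ i → from (shift l xs j (≤-trans (M≤m j) (xs≥m j)) i) (h i)))
    (⇔.sym (⇔E _)))
  where
  -- A shift along axis `j` affects only the `j`-th sides of the `k` boxes, and these finitely many
  -- sets have a common threshold and period.
  common : ∀ j → UniformlyPeriodic {Σ[ l ∈ Fin k ] ⊤} λ (l , _) → E l j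
  common j = UniformlyPeriodic-∀ λ l → let (M , p , p≥1 , h) = per l j in M , p , p≥1 , λ _ → h

  M p : Fin n → ℕ
  M j = proj₁ (common j)
  p j = proj₁ (proj₂ (common j))

  p≥1 : ∀ j → p j ≥ 1
  p≥1 j = proj₁ (proj₂ (proj₂ (common j)))

  m : ℕ
  m = proj₁ (upperBound M)

  M≤m : ∀ j → M j ≤ m
  M≤m = proj₂ (upperBound M)

  shift : ∀ l xs j → lookup xs j ≥ M j → ∀ i →
          E l i (lookup xs i) ⇔ E l i (lookup (xs [ j ]%= (_+ p j)) i)
  shift l xs j x≥M i with i Fin.≟ j
  ... | yes refl = ⇔.trans (proj₂ (proj₂ (proj₂ (common j))) (l , tt) (lookup xs j) x≥M)
                           (≡⇒⇔ (E l j) (sym (lookup∘updateAt j xs)))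
  ... | no i≢j   = ≡⇒⇔ (E l i) (sym (lookup∘updateAt′ i j i≢j xs))

-- From periodic sections to periodic axes

insertAt-[]≔ : ∀ {A : Set} (ys : Vec A n) i j (C x : A) →
               insertAt (ys [ j ]≔ x) i C ≡ insertAt ys i C [ punchIn i j ]≔ x
insertAt-[]≔ ys       zero    j       C x = refl
insertAt-[]≔ (y ∷ ys) (suc i) zero    C x = refl
insertAt-[]≔ (y ∷ ys) (suc i) (suc j) C x = cong (y ∷_) (insertAt-[]≔ ys i j C x)

-- If some other coordinate is below `m`, a section provides the period `q`; otherwise the period
-- `p j` applies. The product serves both cases.
Strong⇒AxisPeriodic : (S : Pred (Vec ℕ (suc n)) 0ℓ) → (∀ i C → AxisPeriodic (Section S i C)) →
                      StronglyUltimatelyPeriodic S → AxisPeriodic S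
Strong⇒AxisPeriodic {n} S sections (m , p , p≥1 , strong) j =
  M ⊔ m , q * p j , *-mono-≤ q≥1 (p≥1 j) , periodic
  where
  -- `punchIn j i` ranges over the axes other than `j`. Once that axis is removed, axis `j` carries
  -- the index given by `punchOut`.
  low : UniformlyPeriodic {Σ[ i ∈ Fin n ] Σ[ C ∈ Fin m ] Vec ℕ n} λ (i , C , ys) x →
          Section S (punchIn j i) (toℕ C) (ys [ punchOut (Fin.punchInᵢ≢i j i) ]≔ x)
  low = UniformlyPeriodic-∀ λ i → UniformlyPeriodic-∀ λ C →
    sections (punchIn j i) (toℕ C) (punchOut (Fin.punchInᵢ≢i j i))

  M   = proj₁ low
  q   = proj₁ (proj₂ low)
  q≥1 = proj₁ (proj₂ (proj₂ low))

  low-periodic : ∀ i xs → lookup xs (punchIn j i) < m → Periodic M q λ x → S (xs [ j ]≔ x)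
  low-periodic i xs lt x x≥M = ⇔.trans (≡⇒⇔ S (sym (eq x)))
    (⇔.trans (proj₂ (proj₂ (proj₂ low)) (i , fromℕ< lt , removeAt xs i′) x x≥M) (≡⇒⇔ S (eq (x + q))))
    where
    i′ = punchIn j i
    i′≢j = Fin.punchInᵢ≢i j i

    eq : ∀ x → insertAt (removeAt xs i′ [ punchOut i′≢j ]≔ x) i′ (toℕ (fromℕ< lt)) ≡ xs [ j ]≔ x
    eq x = trans (insertAt-[]≔ (removeAt xs i′) i′ (punchOut i′≢j) _ x)
      (cong₂ (λ ys k → ys [ k ]≔ x)
        (trans (cong (insertAt (removeAt xs i′) i′) (Fin.toℕ-fromℕ< lt)) (insertAt-removeAt xs i′))
        (Fin.punchIn-punchOut i′≢j))

  high-periodic : ∀ xs → (∀ i → lookup xs (punchIn j i) ≥ m) → Periodic m (p j) λ x → S (xs [ j ]≔ x)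
  high-periodic xs xs≥m x x≥m = ⇔.trans (strong (xs [ j ]≔ x) all≥m j)
    (≡⇒⇔ S (updateAt-updateAt j xs))
    where
    all≥m : ∀ i → lookup (xs [ j ]≔ x) i ≥ m
    all≥m i with i Fin.≟ j
    ... | yes refl = ≤-trans x≥m (≤-reflexive (sym (lookup∘updateAt j xs)))
    ... | no i≢j   = ≤-trans
      (subst (λ k → lookup xs k ≥ m) (Fin.punchIn-punchOut (i≢j ∘ sym)) (xs≥m (punchOut (i≢j ∘ sym))))
      (≤-reflexive (sym (lookup∘updateAt′ i j i≢j xs)))

  periodic : ∀ xs → Periodic (M ⊔ m) (q * p j) λ x → S (xs [ j ]≔ x)
  periodic xs x x≥ with Fin.any? (λ i → lookup xs (punchIn j i) <? m)
  ... | yes (i , lt) = subst (λ r → S (xs [ j ]≔ x) ⇔ S (xs [ j ]≔ (x + r))) (*-comm (p j) q)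
    (Periodic-* {P = λ x → S (xs [ j ]≔ x)} (p j) (low-periodic i xs lt) x (m⊔n≤o⇒m≤o M m x≥))
  ... | no none      = Periodic-* {P = λ x → S (xs [ j ]≔ x)} q
    (high-periodic xs λ i → ≮⇒≥ λ lt → none (i , lt)) x (m⊔n≤o⇒n≤o M m x≥)

-- Automata reading an interval placed beyond the other sets

ones : ℕ → Word
ones x = List.replicate x true

delay : ℕ → Word → Word
delay N W = List.replicate N false ++ W

count-delay : ∀ N W → count (delay N W) ≡ count W
count-delay zero    W = refl
count-delay (suc N) W = count-delay N W

count-ones : ∀ x → count (ones x) ≡ x
count-ones zero    = refl
count-ones (suc x) = cong suc (count-ones x)

length-tail : ∀ W {N} → length W ≤ suc N → length (tail W) ≤ N
length-tail []      _        = z≤n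
length-tail (b ∷ W) (s≤s le) = le

empties : Vec Word n
empties = Vec.replicate _ []

module _ (A : Congruence 0 n) (j : Fin n) where

  congr-[]≔ : ∀ {Vs b W W′} → τ A [] (map tail Vs [ j ]≔ W) ≡ τ A [] (map tail Vs [ j ]≔ W′) →
              τ A [] (Vs [ j ]≔ (b ∷ W)) ≡ τ A [] (Vs [ j ]≔ (b ∷ W′))
  congr-[]≔ {Vs} {b} {W} {W′} eq = congr A [] [] _ _ refl
    (trans (map-[]≔ head Vs j) (sym (map-[]≔ head Vs j)))
    (subst₂ (λ Us Us′ → τ A [] Us ≡ τ A [] Us′) (sym (map-[]≔ tail Vs j)) (sym (map-[]≔ tail Vs j)) eq)

  -- Read from the right, `W` and `W′` pass while all other tracks are still empty. The `N`
  -- remaining letters are the same in both runs, so equal states stay equal.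
  τ-delay : ∀ {W W′} → τ A [] (empties [ j ]≔ W) ≡ τ A [] (empties [ j ]≔ W′) →
            ∀ N Vs → (∀ i → length (lookup Vs i) ≤ N) →
            τ A [] (Vs [ j ]≔ delay N W) ≡ τ A [] (Vs [ j ]≔ delay N W′)
  τ-delay {W} {W′} eq zero Vs short =
    subst (λ Us → τ A [] (Us [ j ]≔ W) ≡ τ A [] (Us [ j ]≔ W′)) (sym (Vs≡[] Vs short)) eq
    where
    Vs≡[] : ∀ {m} (Vs : Vec Word m) → (∀ i → length (lookup Vs i) ≤ 0) → Vs ≡ empties
    Vs≡[] []             short = refl
    Vs≡[] ([] ∷ Vs)      short = cong ([] ∷_) (Vs≡[] Vs (short ∘ suc))
    Vs≡[] ((b ∷ V) ∷ Vs) short with () ← short zero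
  τ-delay eq (suc N) Vs short = congr-[]≔ (τ-delay eq N (map tail Vs) λ i →
    subst (λ V → length V ≤ N) (sym (lookup-map i tail Vs)) (length-tail (lookup Vs i) (short i)))

  state : ℕ → Fin (size A)
  state x = τ A [] (empties [ j ]≔ ones x)

  state-+ : ∀ k {x y} → state x ≡ state y → state (k + x) ≡ state (k + y)
  state-+ zero    eq = eq
  state-+ (suc k) {x} {y} eq = congr-[]≔
    (subst (λ Us → τ A [] (Us [ j ]≔ ones (k + x)) ≡ τ A [] (Us [ j ]≔ ones (k + y)))
           (sym (map-replicate tail [] n)) (state-+ k eq))

  state-periodic : ∃[ M ] ∃[ p ] p ≥ 1 × (∀ x → x ≥ M → state x ≡ state (x + p))
  -- Two of the first `size A + 1` states coincide; `state-+` propagates this coincidence to all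
  -- longer intervals.
  state-periodic with i , i′ , i<i′ , eq ← Fin.pigeonhole (n<1+n (size A)) (state ∘ toℕ) =
    toℕ i , toℕ i′ ∸ toℕ i , m<n⇒0<n∸m i<i′ , λ x x≥M →
      subst₂ (λ y z → state y ≡ state z) (m∸n+n≡m x≥M) (shift x x≥M) (state-+ (x ∸ toℕ i) eq)
    where
    shift : ∀ x → x ≥ toℕ i → x ∸ toℕ i + toℕ i′ ≡ x + (toℕ i′ ∸ toℕ i)
    shift x x≥M = trans (cong (x ∸ toℕ i +_) (sym (m+[n∸m]≡n (<⇒≤ i<i′))))
      (trans (sym (+-assoc (x ∸ toℕ i) (toℕ i) _)) (cong (_+ (toℕ i′ ∸ toℕ i)) (m∸n+n≡m x≥M)))

-- From definability to periodic axes

module _ (em : ExcludedMiddle 0ℓ) where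

  -- Only cardinalities matter, so the `j`-th set may be moved beyond the others. Threshold and
  -- period then come from the automaton and `j` alone, hence are uniform in `xs`.
  Definable⇒AxisPeriodic : (S : Pred (Vec ℕ n) 0ℓ) → Definable (𝓒 S) → AxisPeriodic S
  Definable⇒AxisPeriodic {n} S (φ , ⇔φ) j with M , p , p≥1 , periodic ← state-periodic (automaton em φ) j =
    M , p , p≥1 , λ xs x x≥M → mk⇔ (transfer xs (periodic x x≥M)) (transfer xs (sym (periodic x x≥M)))
    where
    A = automaton em φ

    words : ℕ → Vec ℕ n → ℕ → Vec Word n
    -- The other sets are initial intervals; the bound `N` on their lengths is where the `j`-th
    -- interval starts.
    words N xs x = map ones xs [ j ]≔ delay N (ones x)

    cards : ∀ N xs x → map ∣_∣ (map (fromWord 0) (words N xs x)) ≡ xs [ j ]≔ x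
    cards N xs x = trans (sym (map-∘ ∣_∣ (fromWord 0) (words N xs x)))
      (trans (map-cong (∣fromWord∣ 0) (words N xs x))
      (trans (map-[]≔ count (map ones xs) j)
      (cong₂ (λ ys y → ys [ j ]≔ y)
        (trans (sym (map-∘ count ones xs)) (trans (map-cong count-ones xs) (map-id xs)))
        (trans (count-delay N (ones x)) (count-ones x)))))

    represented : ∀ {m} (Ws : Vec Word m) → Pointwise _≈_ (map (fromWord 0) Ws) Ws
    represented []       = []
    represented (W ∷ Ws) = fromWord≈ W ∷ represented Ws

    transfer : ∀ xs {x y} → state A j x ≡ state A j y → S (xs [ j ]≔ x) → S (xs [ j ]≔ y)
    transfer xs {x} {y} eq s with N , xs≤N ← upperBound (lookup xs) =
      subst S (cards N xs y) (from (⇔φ _) (automaton-sound em φ [] []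
        (represented (words N xs x)) (represented (words N xs y))
        (τ-delay A j eq N (map ones xs) short)
        (to (⇔φ _) (subst S (sym (cards N xs x)) s))))
      where
      short : ∀ i → length (lookup (map ones xs) i) ≤ N
      short i = ≤-trans
        (≤-reflexive (trans (cong length (lookup-map i ones xs)) (length-replicate (lookup xs i)))) (xs≤N i)

  CardDefinable⇒AxisPeriodic : (S : Pred (Vec ℕ n) 0ℓ) → CardDefinable S → AxisPeriodic S
  CardDefinable⇒AxisPeriodic {zero}  S def ()
  CardDefinable⇒AxisPeriodic {suc n} S def = Definable⇒AxisPeriodic S def

theorem2p5 : ExcludedMiddle 0ℓ →
    (n : ℕ) (R : Pred (Vec 𝓕 (suc n)) 0ℓ) → IsCardinalityRelation R →
    (Definable R ⇔ Recognizable (𝓘 R)) ×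
    (Recognizable (𝓘 R) ⇔
      ((∀ i C → CardDefinable (Section (𝓘 R) i C)) × StronglyUltimatelyPeriodic (𝓘 R)))
theorem2p5 em n R card =
  mk⇔ (AxisPeriodic⇒Recognizable S ∘ Definable⇒AxisPeriodic em S ∘ definable-resp R⇔𝓒)
      (definable-resp (⇔.sym ∘ R⇔𝓒) ∘ Recognizable⇒Definable em S) ,
  mk⇔ (λ rec → (λ i C → Definable⇒CardDefinable _ (Recognizable⇒Section-Definable em S rec i C)) ,
               Recognizable⇒StronglyUltimatelyPeriodic S rec)
      -- The automaton argument makes every section axis periodic, which supplies the periods where
      -- some coordinate is small.
      (λ (sections , strong) → AxisPeriodic⇒Recognizable S
        (Strong⇒AxisPeriodic S (λ i C → CardDefinable⇒AxisPeriodic em _ (sections i C)) strong))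
  where
  S = 𝓘 R

  R⇔𝓒 : ∀ Xs → R Xs ⇔ 𝓒 S Xs
  R⇔𝓒 Xs = let (⊆ , ⊇) = 𝓒-unique S R card (id , id) in mk⇔ ⊆ ⊇
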